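{- Let $p_\Delta>0$ and $p_{min}<p_{max}$ be real numbers such that $(p_{max}-p_{min})/p_\Delta$ is an integer, and consider the multiresolution priority queue algorithm with these parameters (routines BUILD, INSERT, EXTRACT as given in the context). The INSERT and EXTRACT routines preserve the MR-PQ invariant. That is, if the data structure is in any state reachable from the state produced by BUILD by a finite sequence of valid INSERT and EXTRACT calls, and that state satisfies the MR-PQ invariant, then the state resulting from one further valid call to INSERT or EXTRACT also satisfies the MR-PQ invariant.
   Context: An element $e$ is a record with a real priority $e.prio$ and two pointers $e.next$, $e.prev$. Inserted elements are required to have priority in $[p_{min},p_{max})$. The data structure. Put $r=(p_{max}-p_{min})/p_\Delta$. The data structure consists of (i) a circular doubly linked list of elements containing a distinguished element $q$, the sentinel, which is never removed, and (ii) a lookup table $qlt$, an array indexed by $0,1,\dots,r$, each entry of which is NULL or a pointer to an element of the list. The slot of an element $e$ is $\mathrm{QltSlot}(e)=\lfloor (e.prio-q.prio)/p_\Delta\rfloor$. BUILD: set $q.next=q.prev=q$, $q.prio=p_{min}-p_\Delta$, $qlt[0]=q$, and $qlt[i]=$ NULL for $1\le i\le r$. INSERT($e$) (valid when $e$ is not currently in the list and $p_{min}\le e.prio<p_{max}$): let $s=\mathrm{QltSlot}(e)$ and let $s'$ be the largest index $s'\le s$ with $qlt[s']\ne$ NULL, found by starting at $s$ and decrementing by one. If $s'=s$, link $e$ into the list immediately before the element $qlt[s]$ (that is, between $qlt[s].prev$ and $qlt[s]$), leaving $qlt$ unchanged. If $s'<s$, link $e$ into the list immediately after the element $qlt[s']$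 (that is, between $qlt[s']$ and $qlt[s'].next$), and then set $qlt[s]=e$. EXTRACT($e$) (valid when $e$ is a non-sentinel element currently in the list): unlink $e$ from the list (set $e.prev.next=e.next$ and $e.next.prev=e.prev$). Then let $s=\mathrm{QltSlot}(e)$. If $qlt[s]\neq e$, do nothing more. Otherwise, if $\mathrm{QltSlot}(e.prev)=s$, set $qlt[s]=e.prev$; else set $qlt[s]=$ NULL. Elements are dequeued in list order, i.e. in the order obtained by following $next$ pointers starting at $q.next$ until $q$ is reached again. MR-PQ invariant: for any two elements $e_i,e_j$ (other than the sentinel) in the queue, with priorities $p_i,p_j\in[p_{min},p_{max})$, if $$\lfloor (p_i-p_{min})/p_\Delta\rfloor<\lfloor (p_j-p_{min})/p_\Delta\rfloor$$ then $e_i$ is dequeued before $e_j$. -}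

module Defs where

open import Algebra.Bundles using (CommutativeRing)
open import Data.Bool.Base using (if_then_else_)
open import Data.Fin.Base as Fin using (Fin; zero; suc; fromℕ<; inject₁)
open import Data.Integer.Base as ℤ using (ℤ; +_; -[1+_])
import Data.Fin.Properties as Fin
import Data.Integer.Properties as ℤ
open import Data.List.Base using (List; []; _∷_; length; lookup)
open import Data.List.Membership.Propositional using (_∈_)
open import Data.Maybe.Base using (Maybe; just; nothing; map; _>>=_)
open import Data.Maybe.Properties using (≡-dec)
open import Data.Nat.Base as ℕ using (ℕ; zero; suc)
import Data.Nat.Properties as ℕ
open import Data.Product.Base as Product using (Σ-syntax; ∃-syntax; _×_; _,_)
open import Data.Vec.Functional using (Vector; updateAt)
open import Function.Base using (const; _∘_)
open import Level using (_⊔_) renaming (suc to lsuc)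
open import Relation.Binary.Core using (Rel)
open import Relation.Binary.Definitions using (DecidableEquality)
open import Relation.Binary.PropositionalEquality.Core using (_≡_; _≢_)
open import Relation.Binary.Structures using (IsTotalOrder)
open import Relation.Nullary using (¬_; yes; no; does)

import Algebra.Definitions.RawMonoid as RawMonoid
import Relation.Binary.Construct.NonStrictToStrict as Strict

record OrderedField c ℓ₁ ℓ₂ : Set (lsuc (c ⊔ ℓ₁ ⊔ ℓ₂)) where
  infix  8 _⁻¹
  infixl 7 _/_
  infix  4 _≤_ _<_

  field
    commutativeRing : CommutativeRing c ℓ₁

  open CommutativeRing commutativeRing public

  field
    0≉1          : ¬ (0# ≈ 1#)
    _⁻¹          : Carrier → Carrier
    ⁻¹-inverseʳ  : ∀ x → ¬ (x ≈ 0#) → x * x ⁻¹ ≈ 1#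
    _≤_          : Rel Carrier ℓ₂
    isTotalOrder : IsTotalOrder _≈_ _≤_
    +-monoˡ-≤    : ∀ {x y} z → x ≤ y → x + z ≤ y + z
    *-nonneg     : ∀ {x y} → 0# ≤ x → 0# ≤ y → 0# ≤ x * y

  _<_ : Rel Carrier (ℓ₁ ⊔ ℓ₂)
  _<_ = Strict._<_ _≈_ _≤_

  _/_ : Carrier → Carrier → Carrier
  x / y = x * y ⁻¹

  fromℕ : ℕ → Carrier
  fromℕ n = RawMonoid._×_ +-rawMonoid n 1#

  fromℤ : ℤ → Carrier
  fromℤ (+ n)    = fromℕ n
  fromℤ -[1+ n ] = - fromℕ (suc n)

-- These stand in for ℝ, which the standard library does not provide:
-- classically, ℝ is an instance.  The two laws determine ⌊_⌋.
record FlooredField c ℓ₁ ℓ₂ : Set (lsuc (c ⊔ ℓ₁ ⊔ ℓ₂)) where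
  field
    orderedField : OrderedField c ℓ₁ ℓ₂

  open OrderedField orderedField public

  field
    ⌊_⌋      : Carrier → ℤ
    ⌊⌋-lower : ∀ x → fromℤ ⌊ x ⌋ ≤ x
    ⌊⌋-upper : ∀ x → x < fromℤ (ℤ.suc ⌊ x ⌋)

module MRPQ
  {c ℓ₁ ℓ₂ a} (R : FlooredField c ℓ₁ ℓ₂)
  {Ptr : Set a} (_≟_ : DecidableEquality Ptr) (q : Ptr)
  (pmin pmax pΔ : FlooredField.Carrier R) (r : ℕ)
  where

  open FlooredField R hiding (zero)

  record Element : Set (c ⊔ a) where
    field
      prio : Carrier
      next : Ptr
      prev : Ptr

  open Element

  -- Every pointer refers to a record, whether or not that element is in the
  -- list; the pointer fields of an element outside the list are arbitrary.
  Memory : Set (c ⊔ a)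
  Memory = Ptr → Element

  modify : Ptr → (Element → Element) → Memory → Memory
  modify x f m y = if does (y ≟ x) then f (m y) else m y

  setNext setPrev : Ptr → Ptr → Memory → Memory
  setNext x y = modify x λ e → record e { next = y }
  setPrev x y = modify x λ e → record e { prev = y }

  setPrio : Ptr → Carrier → Memory → Memory
  setPrio x p = modify x λ e → record e { prio = p }

  Table : ℕ → Set a
  Table n = Vector (Maybe Ptr) (suc n)

  record State : Set (c ⊔ a) where
    field
      mem : Memory
      qlt : Table r

  open State

  qltSlot : Memory → Ptr → ℤ
  qltSlot m e = ⌊ (prio (m e) - prio (m q)) / pΔ ⌋

  -- nothing signals an access outside the array bounds.
  index : ℤ → Maybe (Fin (suc r))
  index (+ n) with n ℕ.<? suc r
  ... | yes n≤r = just (fromℕ< n≤r)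
  ... | no  _   = nothing
  index -[1+ _ ] = nothing

  -- Downward search for the first non-NULL entry, returning its index and
  -- content.  Restricting the table along inject₁ before decrementing keeps
  -- the recursion structural.
  search : ∀ {n} → Table n → Fin (suc n) → Maybe (Fin (suc n) × Ptr)
  search t zero = map (zero ,_) (t zero)
  search {suc n} t (suc i) with t (suc i)
  ... | just x  = just (suc i , x)
  ... | nothing = map (Product.map₁ inject₁) (search (t ∘ inject₁) i)

  linkBetween : Ptr → Ptr → Ptr → Memory → Memory
  linkBetween x e y =
    setPrev y e ∘ setNext x e ∘ setNext e y ∘ setPrev e x

  linkBefore linkAfter : Ptr → Ptr → Memory → Memory
  linkBefore x e m = linkBetween (prev (m x)) e x m
  linkAfter  x e m = linkBetween x e (next (m x)) m

  unlink : Ptr → Memory → Memory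
  unlink e m = setPrev (next (m e)) (prev (m e)) (setNext (prev (m e)) (next (m e)) m)

  build : Memory → State
  build m = record
    { mem = setPrio q (pmin - pΔ) (setPrev q q (setNext q q m))
    ; qlt = λ { zero → just q ; (suc _) → nothing }
    }

  -- The results of insert and extract are nothing exactly when the routine
  -- gets stuck: an index out of bounds, or a search that finds no entry.
  insert : Ptr → State → Maybe State
  insert e σ = do
    s        ← index (qltSlot (mem σ) e)
    (s′ , x) ← search (qlt σ) s
    just (if does (s′ Fin.≟ s)
      then record { mem = linkBefore x e (mem σ) ; qlt = qlt σ }
      else record { mem = linkAfter  x e (mem σ) ; qlt = updateAt (qlt σ) s (const (just e)) })

  extract : Ptr → State → Maybe State
  extract e σ = do
    let m = unlink e (mem σ)
    s ← index (qltSlot m e)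
    just (record
      { mem = m
      ; qlt =
          if does (≡-dec _≟_ (qlt σ s) (just e))
          then updateAt (qlt σ) s (const
                 (if does (qltSlot m (prev (m e)) ℤ.≟ qltSlot m e)
                  then just (prev (m e))
                  else nothing))
          else qlt σ
      })

  data Call : Set a where
    INSERT EXTRACT : Ptr → Call

  exec : Call → State → Maybe State
  exec (INSERT  e) = insert e
  exec (EXTRACT e) = extract e

  -- Traversal m x es: following next pointers from x visits exactly es, in
  -- that order, before q is first reached.
  data Traversal (m : Memory) : Ptr → List Ptr → Set a where
    stop : Traversal m q []
    step : ∀ {x es} → x ≢ q → Traversal m (next (m x)) es → Traversal m x (x ∷ es)

  DequeueOrder : State → List Ptr → Set a
  DequeueOrder σ = Traversal (mem σ) (next (mem σ q))

  Queued : Ptr → State → Set a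
  Queued e σ = ∃[ es ] DequeueOrder σ es × e ∈ es

  InRange : Carrier → Set (ℓ₁ ⊔ ℓ₂)
  InRange p = pmin ≤ p × p < pmax

  data Valid (σ : State) : Call → Set (a ⊔ ℓ₁ ⊔ ℓ₂) where
    insert-valid  : ∀ {e} → e ≢ q → ¬ Queued e σ → InRange (prio (mem σ e)) →
                    Valid σ (INSERT e)
    extract-valid : ∀ {e} → Queued e σ → Valid σ (EXTRACT e)

  data Reachable : State → Set (c ⊔ a ⊔ ℓ₁ ⊔ ℓ₂) where
    built  : ∀ m → Reachable (build m)
    called : ∀ {σ σ′} call → Reachable σ → Valid σ call → exec call σ ≡ just σ′ →
             Reachable σ′

  Invariant : State → Set (a ⊔ ℓ₁ ⊔ ℓ₂)
  Invariant σ = Σ[ es ∈ List Ptr ] DequeueOrder σ es ×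
    (∀ (i j : Fin (length es)) →
      let pᵢ = prio (mem σ (lookup es i))
          pⱼ = prio (mem σ (lookup es j))
      in
      InRange pᵢ → InRange pⱼ →
      ⌊ (pᵢ - pmin) / pΔ ⌋ ℤ.< ⌊ (pⱼ - pmin) / pΔ ⌋ →
      i Fin.< j)

{-# OPTIONS --safe #-}

-- The invariant alone is not inductive, so it is strengthened to: the list,
-- sentinel first, is a well-formed ring whose slots are non-decreasing, and each
-- table entry points to the last element of its slot.  An element of priority p
-- has slot 1 + ⌊(p - pmin) / pΔ⌋, between 1 and r, while the sentinel has slot 0;
-- hence the downward search of insert always succeeds, and it returns the last
-- element of the nearest nonempty slot at or below that of the inserted element.
module Submission where

open import Data.Bool.Base using (true; false; if_then_else_)
open import Data.Fin.Base as Fin using (Fin; zero; suc; toℕ; fromℕ<; inject₁; lower₁)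
import Data.Fin.Properties as Fin
open import Data.Integer.Base as ℤ using (ℤ; +_)
import Data.Integer.Properties as ℤ
open import Data.List.Base using (List; []; _∷_; _++_; [_]; filter; last; lookup)
open import Data.List.Properties
  using (++-assoc; filter-++; filter-accept; filter-reject; filter-none)
open import Data.List.Membership.Propositional using (_∈_)
open import Data.List.Membership.Propositional.Properties using (∈-lookup; ∈-++⁺ʳ)
open import Data.List.Relation.Unary.All as All using (All; []; _∷_)
import Data.List.Relation.Unary.All.Properties as AllP
open import Data.List.Relation.Unary.AllPairs as AllPairs using (AllPairs; []; _∷_)
open import Data.List.Relation.Unary.Any using (here; there)
open import Data.Maybe.Base as Maybe using (Maybe; just; nothing)
open import Data.Maybe.Properties using (≡-dec)
open import Data.Maybe.Relation.Unary.Any as MaybeAny using (Any; just; drop-just)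
open import Data.Nat.Base as ℕ using (ℕ; suc; z≤n; s≤s)
import Data.Nat.Properties as ℕ
open import Data.Product.Base using (Σ-syntax; ∃-syntax; ∃₂; _×_; _,_; proj₁; proj₂)
open import Data.Sum.Base using (_⊎_; inj₁; inj₂)
open import Data.Vec.Functional using (updateAt)
open import Data.Vec.Functional.Properties using (updateAt-updates; updateAt-minimal)
open import Function.Base using (_∘_; flip; const)
open import Level using (_⊔_)
open import Relation.Binary.Bundles using (Poset)
open import Relation.Binary.Core using (Rel)
open import Relation.Binary.Definitions using (DecidableEquality; tri<; tri≈; tri>)
open import Relation.Binary.PropositionalEquality as ≡
  using (_≡_; _≢_; refl; sym; trans; cong; cong₂; subst; subst₂)
open import Relation.Binary.Structures using (IsTotalOrder)
open import Relation.Nullary using (¬_; yes; no; does)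
open import Relation.Nullary.Negation using (contradiction)
open import Relation.Unary using (Pred; Decidable; ∁)
open import Defs

import Relation.Binary.Construct.NonStrictToStrict as Strict

module OrderedFieldProperties {c ℓ₁ ℓ₂} (F : OrderedField c ℓ₁ ℓ₂) where
  open OrderedField F hiding (zero; refl) renaming (sym to ≈-sym; trans to ≈-trans)
  open IsTotalOrder isTotalOrder public
    using (antisym; isPartialOrder; ≤-respˡ-≈; ≤-respʳ-≈)
    renaming (reflexive to ≤-reflexive; refl to ≤-refl; trans to ≤-trans; total to ≤-total)
  open import Algebra.Properties.AbelianGroup +-abelianGroup 
    using (//-rightDividesʳ; ⁻¹-involutive; ε⁻¹≈ε)
  open import Algebra.Properties.Ring ring using (-‿distribʳ-*; -‿distribˡ-*; [y-z]x≈yx-zx)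

  poset : Poset c ℓ₁ ℓ₂
  poset = record { isPartialOrder = isPartialOrder }

  open import Relation.Binary.Reasoning.PartialOrder poset

  <⇒≱ : ∀ {x y} → x < y → ¬ y ≤ x
  <⇒≱ = Strict.<⇒≱ _≈_ _≤_ antisym

  +-monoʳ-≤ : ∀ {x y} z → x ≤ y → z + x ≤ z + y
  +-monoʳ-≤ {x} {y} z x≤y = begin
    z + x ≈⟨ +-comm z x ⟩
    x + z ≤⟨ +-monoˡ-≤ z x≤y ⟩
    y + z ≈⟨ +-comm y z ⟩
    z + y ∎

  +-cancelʳ-≤ : ∀ {x y} z → x + z ≤ y + z → x ≤ y
  +-cancelʳ-≤ {x} {y} z x+z≤y+z = begin
    x         ≈⟨ //-rightDividesʳ z x ⟨
    x + z - z ≤⟨ +-monoˡ-≤ (- z) x+z≤y+z ⟩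
    y + z - z ≈⟨ //-rightDividesʳ z y ⟩
    y         ∎

  x≤y⇒0≤y-x : ∀ {x y} → x ≤ y → 0# ≤ y - x
  x≤y⇒0≤y-x {x} {y} x≤y = begin
    0#    ≈⟨ -‿inverseʳ x ⟨
    x - x ≤⟨ +-monoˡ-≤ (- x) x≤y ⟩
    y - x ∎

  0≤y-x⇒x≤y : ∀ {x y} → 0# ≤ y - x → x ≤ y
  0≤y-x⇒x≤y {x} {y} 0≤y-x = +-cancelʳ-≤ (- x) (begin
    x - x ≈⟨ -‿inverseʳ x ⟩
    0#    ≤⟨ 0≤y-x ⟩
    y - x ∎)

  neg-mono-≤ : ∀ {x y} → x ≤ y → - y ≤ - x
  neg-mono-≤ {x} {y} x≤y = 0≤y-x⇒x≤y (begin
    0#        ≤⟨ x≤y⇒0≤y-x x≤y ⟩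
    y - x     ≈⟨ +-comm y (- x) ⟩
    - x + y   ≈⟨ +-congˡ (⁻¹-involutive y) ⟨
    - x - - y ∎)

  x≤0⇒0≤-x : ∀ {x} → x ≤ 0# → 0# ≤ - x
  x≤0⇒0≤-x x≤0 = ≤-respˡ-≈ ε⁻¹≈ε (neg-mono-≤ x≤0)

  0≤x⇒-x≤0 : ∀ {x} → 0# ≤ x → - x ≤ 0#
  0≤x⇒-x≤0 0≤x = ≤-respʳ-≈ ε⁻¹≈ε (neg-mono-≤ 0≤x)

  0≤1 : 0# ≤ 1#
  0≤1 with ≤-total 0# 1#
  ... | inj₁ 0≤1 = 0≤1
  ... | inj₂ 1≤0 = begin
    0#            ≤⟨ *-nonneg (x≤0⇒0≤-x 1≤0) (x≤0⇒0≤-x 1≤0) ⟩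
    - 1# * - 1#   ≈⟨ -‿distribˡ-* 1# (- 1#) ⟨
    - (1# * - 1#) ≈⟨ -‿cong (*-identityˡ (- 1#)) ⟩
    - - 1#        ≈⟨ ⁻¹-involutive 1# ⟩
    1#            ∎

  1≰0 : ¬ 1# ≤ 0#
  1≰0 1≤0 = 0≉1 (antisym 0≤1 1≤0)

  *-monoˡ-≤ : ∀ {x y z} → 0# ≤ z → x ≤ y → x * z ≤ y * z
  *-monoˡ-≤ {x} {y} {z} 0≤z x≤y = 0≤y-x⇒x≤y (begin
    0#            ≤⟨ *-nonneg (x≤y⇒0≤y-x x≤y) 0≤z ⟩
    (y - x) * z   ≈⟨ [y-z]x≈yx-zx z y x ⟩
    y * z - x * z ∎)

  module _ {x} (0<x : 0# < x) where

    private
      0≤x = proj₁ 0<x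
      x≉0 = proj₂ 0<x ∘ ≈-sym

    x/x≈1 : x / x ≈ 1#
    x/x≈1 = ⁻¹-inverseʳ x x≉0

    ⁻¹-nonneg : 0# ≤ x ⁻¹
    ⁻¹-nonneg with ≤-total 0# (x ⁻¹)
    ... | inj₁ 0≤x⁻¹ = 0≤x⁻¹
    ... | inj₂ x⁻¹≤0 = contradiction 1≤0 1≰0
      where
      1≤0 : 1# ≤ 0#
      1≤0 = 0≤y-x⇒x≤y (begin
        0#           ≤⟨ *-nonneg 0≤x (x≤0⇒0≤-x x⁻¹≤0) ⟩
        x * - (x ⁻¹) ≈⟨ -‿distribʳ-* x (x ⁻¹) ⟨
        - (x / x)    ≈⟨ -‿cong x/x≈1 ⟩
        - 1#         ≈⟨ +-identityˡ (- 1#) ⟨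
        0# - 1#      ∎)

    /-monoˡ-≤ : ∀ {y z} → y ≤ z → y / x ≤ z / x
    /-monoˡ-≤ = *-monoˡ-≤ ⁻¹-nonneg

    y/x*x≈y : ∀ y → y / x * x ≈ y
    y/x*x≈y y = begin-equality
      y * x ⁻¹ * x   ≈⟨ *-assoc y (x ⁻¹) x ⟩
      y * (x ⁻¹ * x) ≈⟨ *-congˡ (*-comm (x ⁻¹) x) ⟩
      y * (x / x)    ≈⟨ *-congˡ x/x≈1 ⟩
      y * 1#         ≈⟨ *-identityʳ y ⟩
      y              ∎

    /-cancelʳ-≤ : ∀ {y z} → y / x ≤ z / x → y ≤ z
    /-cancelʳ-≤ {y} {z} y/x≤z/x = begin
      y         ≈⟨ y/x*x≈y y ⟨
      y / x * x ≤⟨ *-monoˡ-≤ 0≤x y/x≤z/x ⟩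
      z / x * x ≈⟨ y/x*x≈y z ⟩
      z         ∎

    [y+x]/x≈1+y/x : ∀ y → (y + x) / x ≈ 1# + y / x
    [y+x]/x≈1+y/x y = begin-equality
      (y + x) / x   ≈⟨ distribʳ (x ⁻¹) y x ⟩
      y / x + x / x ≈⟨ +-congˡ x/x≈1 ⟩
      y / x + 1#    ≈⟨ +-comm (y / x) 1# ⟩
      1# + y / x    ∎

  fromℕ-nonneg : ∀ n → 0# ≤ fromℕ n
  fromℕ-nonneg ℕ.zero  = ≤-refl
  fromℕ-nonneg (suc n)  = begin
    0#           ≤⟨ fromℕ-nonneg n ⟩
    fromℕ n      ≈⟨ +-identityˡ (fromℕ n) ⟨
    0# + fromℕ n ≤⟨ +-monoˡ-≤ (fromℕ n) 0≤1 ⟩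
    1# + fromℕ n ∎

  fromℕ-mono-≤ : ∀ {m n} → m ℕ.≤ n → fromℕ m ≤ fromℕ n
  fromℕ-mono-≤ {n = n} z≤n   = fromℕ-nonneg n
  fromℕ-mono-≤ (s≤s m≤n) = +-monoʳ-≤ 1# (fromℕ-mono-≤ m≤n)

  fromℤ-mono-≤ : ∀ {i j} → i ℤ.≤ j → fromℤ i ≤ fromℤ j
  fromℤ-mono-≤ (ℤ.-≤- n≤m)         = neg-mono-≤ (fromℕ-mono-≤ (s≤s n≤m))
  fromℤ-mono-≤ (ℤ.-≤+ {m} {n}) =
    ≤-trans (0≤x⇒-x≤0 (fromℕ-nonneg (suc m))) (fromℕ-nonneg n)
  fromℤ-mono-≤ (ℤ.+≤+ m≤n)         = fromℕ-mono-≤ m≤n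

module FloorProperties {c ℓ₁ ℓ₂} (R : FlooredField c ℓ₁ ℓ₂) where
  open FlooredField R hiding (zero; refl) renaming (sym to ≈-sym; trans to ≈-trans)
  open OrderedFieldProperties orderedField public

  fromℤ≤⇒≤⌊⌋ : ∀ {n x} → fromℤ n ≤ x → n ℤ.≤ ⌊ x ⌋
  fromℤ≤⇒≤⌊⌋ {n} {x} n≤x = ℤ.≮⇒≥ λ ⌊x⌋<n →
    <⇒≱ (⌊⌋-upper x) (≤-trans (fromℤ-mono-≤ (ℤ.i<j⇒suc[i]≤j ⌊x⌋<n)) n≤x)

  ≰⇒⌊⌋< : ∀ {n x} → ¬ fromℤ n ≤ x → ⌊ x ⌋ ℤ.< n
  ≰⇒⌊⌋< {n} {x} n≰x = ℤ.≰⇒> λ n≤⌊x⌋ →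
    n≰x (≤-trans (fromℤ-mono-≤ n≤⌊x⌋) (⌊⌋-lower x))

  ⌊⌋-unique : ∀ {n x} → fromℤ n ≤ x → ¬ fromℤ (ℤ.suc n) ≤ x → ⌊ x ⌋ ≡ n
  ⌊⌋-unique {n} {x} n≤x 1+n≰x = ℤ.≤-antisym
    (subst (⌊ x ⌋ ℤ.≤_) (ℤ.pred-suc n) (ℤ.i<j⇒i≤pred[j] (≰⇒⌊⌋< {ℤ.suc n} 1+n≰x)))
    (fromℤ≤⇒≤⌊⌋ n≤x)

  module Grid (pmin pmax pΔ : Carrier) (0<pΔ : 0# < pΔ) (r : ℕ)
              ([pmax-pmin]/pΔ≈r : (pmax - pmin) / pΔ ≈ fromℤ (+ r)) where

    open import Relation.Binary.Reasoning.PartialOrder poset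
    open import Algebra.Properties.AbelianGroup +-abelianGroup using (⁻¹-anti-homo‿-)

    ⌊[x-x]/pΔ⌋≡0 : ∀ x → ⌊ (x - x) / pΔ ⌋ ≡ + 0
    ⌊[x-x]/pΔ⌋≡0 x = ⌊⌋-unique (≤-reflexive (≈-sym ≈0))
      λ 1≤ → 1≰0 (≤-respˡ-≈ (+-identityʳ 1#) (≤-respʳ-≈ ≈0 1≤))
      where
      ≈0 : (x - x) / pΔ ≈ 0#
      ≈0 = ≈-trans (*-congʳ (-‿inverseʳ x)) (zeroˡ (pΔ ⁻¹))

    shift : ∀ p → (p - (pmin - pΔ)) / pΔ ≈ 1# + (p - pmin) / pΔ
    shift p = begin-equality
      (p - (pmin - pΔ)) / pΔ ≈⟨ *-congʳ (+-congˡ (⁻¹-anti-homo‿- pmin pΔ)) ⟩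
      (p + (pΔ - pmin)) / pΔ ≈⟨ *-congʳ (+-congˡ (+-comm pΔ (- pmin))) ⟩
      (p + (- pmin + pΔ)) / pΔ ≈⟨ *-congʳ (+-assoc p (- pmin) pΔ) ⟨
      (p - pmin + pΔ) / pΔ   ≈⟨ [y+x]/x≈1+y/x 0<pΔ (p - pmin) ⟩
      1# + (p - pmin) / pΔ   ∎

    level : ∀ {p} → pmin ≤ p → p < pmax →
            ∃[ k ] k ℕ.< r × ⌊ (p - pmin) / pΔ ⌋ ≡ + k
    level {p} pmin≤p p<pmax with ⌊ (p - pmin) / pΔ ⌋ | fromℤ≤⇒≤⌊⌋ {+ 0} 0≤x | ≰⇒⌊⌋< {+ r} r≰x
      where
      0≤x : 0# ≤ (p - pmin) / pΔ
      0≤x = *-nonneg (x≤y⇒0≤y-x pmin≤p) (⁻¹-nonneg 0<pΔ)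
      r≰x : ¬ fromℤ (+ r) ≤ (p - pmin) / pΔ
      r≰x r≤x = <⇒≱ p<pmax (+-cancelʳ-≤ (- pmin)
        (/-cancelʳ-≤ 0<pΔ (≤-respˡ-≈ (≈-sym [pmax-pmin]/pΔ≈r) r≤x)))
    ... | + k | _ | ℤ.+<+ k<r = k , k<r , refl

    slot-level : ∀ {p k} → ⌊ (p - pmin) / pΔ ⌋ ≡ + k → ⌊ (p - (pmin - pΔ)) / pΔ ⌋ ≡ + suc k
    slot-level {p} {k} ⌊x⌋≡k = ⌊⌋-unique
      (begin
        1# + fromℕ k           ≤⟨ +-monoʳ-≤ 1# k≤x ⟩
        1# + x                 ≈⟨ shift p ⟨
        (p - (pmin - pΔ)) / pΔ ∎)
      λ 2+k≤ → <⇒≱ x<1+k (+-cancelʳ-≤ 1# (begin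
        fromℕ (suc k) + 1#     ≈⟨ +-comm (fromℕ (suc k)) 1# ⟩
        1# + fromℕ (suc k)     ≤⟨ 2+k≤ ⟩
        (p - (pmin - pΔ)) / pΔ ≈⟨ shift p ⟩
        1# + x                 ≈⟨ +-comm 1# x ⟩
        x + 1#                 ∎))
      where
      x = (p - pmin) / pΔ
      k≤x : fromℕ k ≤ x
      k≤x = subst (λ i → fromℤ i ≤ x) ⌊x⌋≡k (⌊⌋-lower x)
      x<1+k : x < fromℕ (suc k)
      x<1+k = subst (λ i → x < fromℤ (ℤ.suc i)) ⌊x⌋≡k (⌊⌋-upper x)

module _ {a} {A : Set a} where

  last-++-∷ : ∀ xs (y : A) ys → last (xs ++ y ∷ ys) ≡ last (y ∷ ys)
  last-++-∷ []            y ys = refl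
  last-++-∷ (x ∷ [])      y ys = refl
  last-++-∷ (x ∷ x′ ∷ xs) y ys = last-++-∷ (x′ ∷ xs) y ys

  last-∷ : ∀ (x : A) xs → last (x ∷ xs) ≢ nothing
  last-∷ x []        ()
  last-∷ x (x′ ∷ xs) eq = last-∷ x′ xs eq

  predecessor : ∀ {z y : A} {zs} → y ∈ zs →
                ∃₂ λ xs x → ∃[ ys ] z ∷ zs ≡ xs ++ x ∷ y ∷ ys
  predecessor {z} {zs = _ ∷ zs} (here refl) = [] , z , zs , refl
  predecessor {z} (there y∈zs) with xs , x , ys , eq ← predecessor y∈zs =
    z ∷ xs , x , ys , cong (z ∷_) eq

module _ {a p} {A : Set a} {P : Pred A p} (P? : Decidable P) where

  filter≡[]⇒none : ∀ xs → filter P? xs ≡ [] → All (∁ P) xs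
  filter≡[]⇒none []       _  = []
  filter≡[]⇒none (x ∷ xs) eq with P? x
  ... | no ¬px = ¬px ∷ filter≡[]⇒none xs eq

  last-filter-just : ∀ {x} xs → last (filter P? xs) ≡ just x →
                     ∃₂ λ ys zs → xs ≡ ys ++ x ∷ zs × P x × All (∁ P) zs
  last-filter-just (y ∷ xs) eq with P? y
  ... | no ¬py with ys , zs , refl , rest ← last-filter-just xs eq = y ∷ ys , zs , refl , rest
  ... | yes py with filter P? xs in fxs≡
  ...   | [] with refl ← eq = [] , xs , refl , py , filter≡[]⇒none xs fxs≡
  ...   | w ∷ ws
    with ys , zs , refl , rest ← last-filter-just xs (trans (cong last fxs≡) eq) =
    y ∷ ys , zs , refl , rest

  last-filter-nothing : ∀ xs → last (filter P? xs) ≡ nothing → All (∁ P) xs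
  last-filter-nothing xs eq with filter P? xs in fxs≡
  ... | []     = filter≡[]⇒none xs fxs≡
  ... | y ∷ ys = contradiction eq (last-∷ y ys)

  last-filter-++ : ∀ xs {ys} → filter P? ys ≢ [] →
                   last (filter P? (xs ++ ys)) ≡ last (filter P? ys)
  last-filter-++ xs {ys} ≢[] with filter P? ys | filter-++ P? xs ys
  ... | []     | _  = contradiction refl ≢[]
  ... | z ∷ zs | eq = trans (cong last eq) (last-++-∷ (filter P? xs) z zs)

  filter-∷-≢[] : ∀ {x xs} → P x → filter P? (x ∷ xs) ≢ []
  filter-∷-≢[] {x} px eq with P? x
  ... | no ¬px = ¬px px
  ... | yes _ with () ← eq

  last-filter-++-∷ : ∀ xs {x ys} → P x →
                     last (filter P? (xs ++ x ∷ ys)) ≡ last (x ∷ filter P? ys)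
  last-filter-++-∷ xs {x} {ys} px = trans
    (last-filter-++ xs (filter-∷-≢[] px))
    (cong last (filter-accept P? px))

  filter-skip : ∀ xs {x ys} → ¬ P x → filter P? (xs ++ x ∷ ys) ≡ filter P? (xs ++ ys)
  filter-skip xs {x} {ys} ¬px = begin
    filter P? (xs ++ x ∷ ys)           ≡⟨ filter-++ P? xs (x ∷ ys) ⟩
    filter P? xs ++ filter P? (x ∷ ys) ≡⟨ cong (filter P? xs ++_) (filter-reject P? ¬px) ⟩
    filter P? xs ++ filter P? ys       ≡⟨ filter-++ P? xs ys ⟨
    filter P? (xs ++ ys)               ∎
    where open ≡.≡-Reasoning

module _ {a ℓ} {A : Set a} {R : Rel A ℓ} where

  AllPairs-middle⁻ : ∀ xs {x ys} → AllPairs R (xs ++ x ∷ ys) →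
                     All (λ y → R y x) xs × All (R x) ys × AllPairs R (xs ++ ys)
  AllPairs-middle⁻ []       (Rxs ∷ Rs) = [] , Rxs , Rs
  AllPairs-middle⁻ (y ∷ xs) (Rxs ∷ Rs)
    with before , after , rest ← AllPairs-middle⁻ xs Rs
    with Rxs₁ , Ryx ∷ Rxs₂ ← AllP.++⁻ xs Rxs =
    Ryx ∷ before , after , AllP.++⁺ Rxs₁ Rxs₂ ∷ rest

  AllPairs-middle⁺ : ∀ xs {x ys} → All (λ y → R y x) xs → All (R x) ys →
                     AllPairs R (xs ++ ys) → AllPairs R (xs ++ x ∷ ys)
  AllPairs-middle⁺ []       []             after Rs         = after ∷ Rs
  AllPairs-middle⁺ (y ∷ xs) (Ryx ∷ before) after (Rxs ∷ Rs)
    with Rxs₁ , Rxs₂ ← AllP.++⁻ xs Rxs =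
    AllP.++⁺ Rxs₁ (Ryx ∷ Rxs₂) ∷ AllPairs-middle⁺ xs before after Rs

  AllPairs-lookup : ∀ {xs i j} → AllPairs R xs → i Fin.< j → R (lookup xs i) (lookup xs j)
  AllPairs-lookup {_ ∷ xs} {zero}  {suc j} (Rxs ∷ _) _         = All.lookup Rxs (∈-lookup j)
  AllPairs-lookup {_ ∷ xs} {suc i} {suc j} (_ ∷ Rs)  (s≤s i<j) = AllPairs-lookup Rs i<j

module _ {a} {A : Set a} where

  data Path (f : A → A) : A → List A → A → Set a where
    []  : ∀ {x} → Path f x [] x
    _∷_ : ∀ x {xs y} → Path f (f x) xs y → Path f x (x ∷ xs) y

  module _ {f : A → A} where

    Path-++⁻ : ∀ xs {x y ys z} → Path f x (xs ++ y ∷ ys) z →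
               Path f x xs y × Path f (f y) ys z
    Path-++⁻ []       (_ ∷ path) = [] , path
    Path-++⁻ (x ∷ xs) (_ ∷ path) with path₁ , path₂ ← Path-++⁻ xs path = x ∷ path₁ , path₂

    Path-++⁺ : ∀ {xs x y ys z} → Path f x xs y → Path f y ys z → Path f x (xs ++ ys) z
    Path-++⁺ []           path₂ = path₂
    Path-++⁺ (x ∷ path₁) path₂ = x ∷ Path-++⁺ path₁ path₂

    Path-respˡ : ∀ {x y xs z} → x ≡ y → Path f x xs z → Path f y xs z
    Path-respˡ refl path = path

    Path-start : ∀ {p} {P : Pred A p} {x xs z} → Path f x xs z → All P xs → P z → P x
    Path-start []      []      pz = pz
    Path-start (_ ∷ _) (px ∷ _) _ = px

    Path-images : ∀ {p} {P : Pred A p} {x xs z} →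
                  Path f x xs z → All P xs → P z → All (P ∘ f) xs
    Path-images []         []         _  = []
    Path-images (_ ∷ path) (_ ∷ pxs) pz = Path-start path pxs pz ∷ Path-images path pxs pz

  Path-cong : ∀ {f g : A → A} {x xs y} →
              All (λ z → f z ≡ g z) xs → Path f x xs y → Path g x xs y
  Path-cong []          []         = []
  Path-cong (eq ∷ eqs) (x ∷ path) = x ∷ Path-respˡ eq (Path-cong eqs path)

module MRPQProperties {c ℓ₁ ℓ₂ a} (R : FlooredField c ℓ₁ ℓ₂)
  {Ptr : Set a} (_≟_ : DecidableEquality Ptr) (q : Ptr)
  (pmin pmax pΔ : FlooredField.Carrier R) (r : ℕ) where

  open FlooredField R using (Carrier; 0#; _≈_; _<_; _-_; _/_; ⌊_⌋; fromℤ)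
  open MRPQ R _≟_ q pmin pmax pΔ r
  open Element
  open State

  modify-≡ : ∀ x f m → modify x f m x ≡ f (m x)
  modify-≡ x f m with x ≟ x
  ... | yes _  = refl
  ... | no x≢x = contradiction refl x≢x

  modify-≢ : ∀ {x y} f m → y ≢ x → modify x f m y ≡ m y
  modify-≢ {x} {y} f m y≢x with y ≟ x
  ... | yes y≡x = contradiction y≡x y≢x
  ... | no _    = refl

  modify-preserves : ∀ {b} {B : Set b} (π : Element → B) x f m y →
                     (∀ e → π (f e) ≡ π e) → π (modify x f m y) ≡ π (m y)
  modify-preserves π x f m y f-preserves with does (y ≟ x)
  ... | true  = f-preserves (m y)
  ... | false = refl

  private
    withNext withPrev : Ptr → Element → Element
    withNext y e = record e { next = y }
    withPrev y e = record e { prev = y }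

    withPrio : Carrier → Element → Element
    withPrio x e = record e { prio = x }

  next-setPrev : ∀ x y m z → next (setPrev x y m z) ≡ next (m z)
  next-setPrev x y m z = modify-preserves next x (withPrev y) m z λ _ → refl

  prev-setNext : ∀ x y m z → prev (setNext x y m z) ≡ prev (m z)
  prev-setNext x y m z = modify-preserves prev x (withNext y) m z λ _ → refl

  prio-setNext : ∀ x y m z → prio (setNext x y m z) ≡ prio (m z)
  prio-setNext x y m z = modify-preserves prio x (withNext y) m z λ _ → refl

  prio-setPrev : ∀ x y m z → prio (setPrev x y m z) ≡ prio (m z)
  prio-setPrev x y m z = modify-preserves prio x (withPrev y) m z λ _ → refl

  next-setNext-≡ : ∀ x y m → next (setNext x y m x) ≡ y
  next-setNext-≡ x y m = cong next (modify-≡ x (withNext y) m)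

  next-setNext-≢ : ∀ {x z} y m → z ≢ x → next (setNext x y m z) ≡ next (m z)
  next-setNext-≢ y m z≢x = cong next (modify-≢ (withNext y) m z≢x)

  prev-setPrev-≡ : ∀ x y m → prev (setPrev x y m x) ≡ y
  prev-setPrev-≡ x y m = cong prev (modify-≡ x (withPrev y) m)

  prev-setPrev-≢ : ∀ {x z} y m → z ≢ x → prev (setPrev x y m z) ≡ prev (m z)
  prev-setPrev-≢ y m z≢x = cong prev (modify-≢ (withPrev y) m z≢x)

  module _ (x e y : Ptr) (m : Memory) where

    private
      m₁ = setPrev e x m
      m₂ = setNext e y m₁
      m₃ = setNext x e m₂

    prio-linkBetween : ∀ z → prio (linkBetween x e y m z) ≡ prio (m z)
    prio-linkBetween z = begin
      prio (linkBetween x e y m z) ≡⟨ prio-setPrev y e m₃ z ⟩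
      prio (m₃ z)                  ≡⟨ prio-setNext x e m₂ z ⟩
      prio (m₂ z)                  ≡⟨ prio-setNext e y m₁ z ⟩
      prio (m₁ z)                  ≡⟨ prio-setPrev e x m z ⟩
      prio (m z)                   ∎
      where open ≡.≡-Reasoning

    next-linkBetween-left : next (linkBetween x e y m x) ≡ e
    next-linkBetween-left = trans (next-setPrev y e m₃ x) (next-setNext-≡ x e m₂)

    next-linkBetween-new : e ≢ x → next (linkBetween x e y m e) ≡ y
    next-linkBetween-new e≢x = begin
      next (linkBetween x e y m e) ≡⟨ next-setPrev y e m₃ e ⟩
      next (m₃ e)                  ≡⟨ next-setNext-≢ e m₂ e≢x ⟩
      next (m₂ e)                  ≡⟨ next-setNext-≡ e y m₁ ⟩
      y                            ∎
      where open ≡.≡-Reasoning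

    next-linkBetween-other : ∀ {z} → z ≢ x → z ≢ e → next (linkBetween x e y m z) ≡ next (m z)
    next-linkBetween-other {z} z≢x z≢e = begin
      next (linkBetween x e y m z) ≡⟨ next-setPrev y e m₃ z ⟩
      next (m₃ z)                  ≡⟨ next-setNext-≢ e m₂ z≢x ⟩
      next (m₂ z)                  ≡⟨ next-setNext-≢ y m₁ z≢e ⟩
      next (m₁ z)                  ≡⟨ next-setPrev e x m z ⟩
      next (m z)                   ∎
      where open ≡.≡-Reasoning

    private
      prev-m₃ : ∀ z → prev (m₃ z) ≡ prev (m₁ z)
      prev-m₃ z = trans (prev-setNext x e m₂ z) (prev-setNext e y m₁ z)

    prev-linkBetween-right : prev (linkBetween x e y m y) ≡ e
    prev-linkBetween-right = prev-setPrev-≡ y e m₃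

    prev-linkBetween-new : e ≢ y → prev (linkBetween x e y m e) ≡ x
    prev-linkBetween-new e≢y = begin
      prev (linkBetween x e y m e) ≡⟨ prev-setPrev-≢ e m₃ e≢y ⟩
      prev (m₃ e)                  ≡⟨ prev-m₃ e ⟩
      prev (m₁ e)                  ≡⟨ prev-setPrev-≡ e x m ⟩
      x                            ∎
      where open ≡.≡-Reasoning

    prev-linkBetween-other : ∀ {z} → z ≢ y → z ≢ e → prev (linkBetween x e y m z) ≡ prev (m z)
    prev-linkBetween-other {z} z≢y z≢e = begin
      prev (linkBetween x e y m z) ≡⟨ prev-setPrev-≢ e m₃ z≢y ⟩
      prev (m₃ z)                  ≡⟨ prev-m₃ z ⟩
      prev (m₁ z)                  ≡⟨ prev-setPrev-≢ x m z≢e ⟩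
      prev (m z)                   ∎
      where open ≡.≡-Reasoning

  module _ (e : Ptr) (m : Memory) where

    private
      x  = prev (m e)
      y  = next (m e)
      m₁ = setNext x y m

    prio-unlink : ∀ z → prio (unlink e m z) ≡ prio (m z)
    prio-unlink z = trans (prio-setPrev y x m₁ z) (prio-setNext x y m z)

    next-unlink-prev : next (unlink e m (prev (m e))) ≡ next (m e)
    next-unlink-prev = trans (next-setPrev y x m₁ x) (next-setNext-≡ x y m)

    next-unlink-other : ∀ {z} → z ≢ prev (m e) → next (unlink e m z) ≡ next (m z)
    next-unlink-other {z} z≢x = trans (next-setPrev y x m₁ z) (next-setNext-≢ y m z≢x)

    prev-unlink-next : prev (unlink e m (next (m e))) ≡ prev (m e)
    prev-unlink-next = prev-setPrev-≡ y x m₁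

    prev-unlink-other : ∀ {z} → z ≢ next (m e) → prev (unlink e m z) ≡ prev (m z)
    prev-unlink-other {z} z≢y = trans (prev-setPrev-≢ x m₁ z≢y) (prev-setNext x y m z)

  -- Injectivity of next on the ring comes for free from prev ∘ next ≡ id, so no
  -- separate path of prev pointers is needed.
  record Ring (m : Memory) (l : List Ptr) : Set (c ⊔ a) where
    field
      path      : Path (next ∘ m) q l q
      prev-next : All (λ x → prev (m (next (m x))) ≡ x) l

  open Ring

  Ring-insert : ∀ {m} xs {x ys e} → Ring m (xs ++ x ∷ ys) → e ≢ q →
                AllPairs _≢_ (xs ++ x ∷ ys) → All (_≢ e) (xs ++ x ∷ ys) →
                Ring (linkBetween x e (next (m x)) m) (xs ++ x ∷ e ∷ ys)
  Ring-insert {m} xs {x} {ys} {e} ring e≢q unique e∉l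
    with xs≢x , x≢ys , _ ← AllPairs-middle⁻ xs unique
       | xs≢e , x≢e ∷ ys≢e ← AllP.++⁻ xs e∉l
       | pxs , px ∷ pys ← AllP.++⁻ xs (prev-next ring)
       | pathˡ , pathʳ ← Path-++⁻ xs (path ring)
       | nxs , nx≢e ∷ nys ← AllP.++⁻ xs (Path-images (path ring) e∉l (e≢q ∘ sym)) = record
    { path = Path-++⁺ (Path-cong (All.map (sym ∘ next-other) xs′) pathˡ)
        (x ∷ Path-respˡ (sym next-x)
          (e ∷ Path-respˡ (sym next-e) (Path-cong (All.map (sym ∘ next-other) ys′) pathʳ)))
    ; prev-next = AllP.++⁺ (All.map prev-next-other xs′)
        (trans (cong (prev ∘ m′) next-x) (prev-linkBetween-new x e y m (nx≢e ∘ sym))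
        ∷ trans (cong (prev ∘ m′) next-e) (prev-linkBetween-right x e y m)
        ∷ All.map prev-next-other ys′)
    }
    where
    y  = next (m x)
    m′ = linkBetween x e y m
    Undisturbed : Ptr → Set a
    Undisturbed z = (z ≢ x × z ≢ e) × next (m z) ≢ e × prev (m (next (m z))) ≡ z
    xs′ : All Undisturbed xs
    xs′ = All.zip (All.zip (xs≢x , xs≢e) , All.zip (nxs , pxs))
    ys′ : All Undisturbed ys
    ys′ = All.zip (All.zip (All.map (_∘ sym) x≢ys , ys≢e) , All.zip (nys , pys))
    next-x : next (m′ x) ≡ e
    next-x = next-linkBetween-left x e y m
    next-e : next (m′ e) ≡ y
    next-e = next-linkBetween-new x e y m (x≢e ∘ sym)
    next-other : ∀ {z} → Undisturbed z → next (m′ z) ≡ next (m z)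
    next-other ((z≢x , z≢e) , _) = next-linkBetween-other x e y m z≢x z≢e
    prev-next-other : ∀ {z} → Undisturbed z → prev (m′ (next (m′ z))) ≡ z
    prev-next-other {z} u@((z≢x , z≢e) , nz≢e , pz) = begin
      prev (m′ (next (m′ z))) ≡⟨ cong (prev ∘ m′) (next-other u) ⟩
      prev (m′ (next (m z)))  ≡⟨ prev-linkBetween-other x e y m nz≢y nz≢e ⟩
      prev (m (next (m z)))   ≡⟨ pz ⟩
      z                       ∎
      where
      open ≡.≡-Reasoning
      nz≢y : next (m z) ≢ y
      nz≢y nz≡y = z≢x (trans (sym pz) (trans (cong (prev ∘ m) nz≡y) px))

  Ring-next : ∀ {m} xs {x y ys} → Ring m (xs ++ x ∷ y ∷ ys) → next (m x) ≡ y
  Ring-next xs ring with _ ∷ _ ← proj₂ (Path-++⁻ xs (path ring)) = refl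

  Ring-prev : ∀ {m} xs {x y ys} → Ring m (xs ++ x ∷ y ∷ ys) → prev (m y) ≡ x
  Ring-prev {m} xs {x} {y} ring with _ , px ∷ _ ← AllP.++⁻ xs (prev-next ring) =
    trans (cong (prev ∘ m) (sym (Ring-next xs ring))) px

  Ring-extract : ∀ {m} xs {x e ys} → Ring m (xs ++ x ∷ e ∷ ys) →
                 AllPairs _≢_ (xs ++ x ∷ e ∷ ys) →
                 Ring (unlink e m) (xs ++ x ∷ ys) × prev (unlink e m e) ≡ x
  Ring-extract {m} xs {x} {e} {ys} ring unique
    with xs≢x , x≢e ∷ x≢ys , unique′ ← AllPairs-middle⁻ xs unique
    with xs≢e , e≢ys , _ ← AllPairs-middle⁻ xs unique′
       | pxs , px ∷ pe ∷ pys ← AllP.++⁻ xs (prev-next ring)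
       | pathˡ , _ ∷ pathʳ ← Path-++⁻ xs (path ring) =
    record
      { path = Path-++⁺ (Path-cong (All.map (sym ∘ next-other) xs′) pathˡ)
          (x ∷ Path-respˡ (sym next-x) (Path-cong (All.map (sym ∘ next-other) ys′) pathʳ))
      ; prev-next = AllP.++⁺ (All.map prev-next-other xs′)
          (trans (cong (prev ∘ m′) next-x) (trans (prev-unlink-next e m) prev-e)
          ∷ All.map prev-next-other ys′)
      }
    , trans (prev-unlink-other e m e≢ne) prev-e
    where
    m′ = unlink e m
    prev-e : prev (m e) ≡ x
    prev-e = Ring-prev xs ring
    e≢ne : e ≢ next (m e)
    e≢ne e≡ne = x≢e (trans (sym prev-e) (trans (cong (prev ∘ m) e≡ne) pe))
    Undisturbed : Ptr → Set a
    Undisturbed z = (z ≢ x × z ≢ e) × prev (m (next (m z))) ≡ z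
    xs′ : All Undisturbed xs
    xs′ = All.zip (All.zip (xs≢x , xs≢e) , pxs)
    ys′ : All Undisturbed ys
    ys′ = All.zip (All.zip (All.map (_∘ sym) x≢ys , All.map (_∘ sym) e≢ys) , pys)
    next-x : next (m′ x) ≡ next (m e)
    next-x = subst (λ z → next (m′ z) ≡ next (m e)) prev-e (next-unlink-prev e m)
    next-other : ∀ {z} → Undisturbed z → next (m′ z) ≡ next (m z)
    next-other ((z≢x , _) , _) = next-unlink-other e m λ z≡ → z≢x (trans z≡ prev-e)
    prev-next-other : ∀ {z} → Undisturbed z → prev (m′ (next (m′ z))) ≡ z
    prev-next-other {z} u@((_ , z≢e) , pz) = begin
      prev (m′ (next (m′ z))) ≡⟨ cong (prev ∘ m′) (next-other u) ⟩
      prev (m′ (next (m z)))  ≡⟨ prev-unlink-other e m nz≢ne ⟩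
      prev (m (next (m z)))   ≡⟨ pz ⟩
      z                       ∎
      where
      open ≡.≡-Reasoning
      nz≢ne : next (m z) ≢ next (m e)
      nz≢ne nz≡ne = z≢e (trans (sym pz) (trans (cong (prev ∘ m) nz≡ne) pe))

  Traversal-functional : ∀ {m x xs ys} → Traversal m x xs → Traversal m x ys → xs ≡ ys
  Traversal-functional stop         stop         = refl
  Traversal-functional stop         (step q≢q _) = contradiction refl q≢q
  Traversal-functional (step q≢q _) stop         = contradiction refl q≢q
  Traversal-functional (step _ t)   (step _ t′)  = cong (_ ∷_) (Traversal-functional t t′)

  Path⇒Traversal : ∀ {m x xs} → Path (next ∘ m) x xs q → All (_≢ q) xs → Traversal m x xs
  Path⇒Traversal []         []           = stop
  Path⇒Traversal (_ ∷ path) (x≢q ∷ xs≢q) = step x≢q (Path⇒Traversal path xs≢q)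

  index-toℕ : ∀ i → index (+ toℕ i) ≡ just i
  index-toℕ i with toℕ i ℕ.<? suc r
  ... | yes i<1+r = cong just (Fin.fromℕ<-toℕ i i<1+r)
  ... | no  i≮1+r = contradiction (Fin.toℕ<n i) i≮1+r

  record Found {n} (t : Table n) (i : Fin (suc n)) : Set a where
    constructor found
    field
      {slot}    : Fin (suc n)
      {content} : Ptr
      result    : search t i ≡ just (slot , content)
      entry     : t slot ≡ just content
      below     : slot Fin.≤ i
      gap       : ∀ j → slot Fin.< j → j Fin.≤ i → t j ≡ nothing

  search-finds : ∀ {n} (t : Table n) i → t zero ≢ nothing → Found t i
  search-finds t zero t₀≢nothing with t zero in t₀≡
  ... | nothing = contradiction refl t₀≢nothing
  ... | just x  =
    found (cong (Maybe.map (zero ,_)) t₀≡) t₀≡ z≤n λ j 0<j j≤0 → contradiction 0<j (ℕ.≤⇒≯ j≤0)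
  search-finds {suc n} t (suc i) t₀≢nothing
    with t (suc i) in tᵢ≡ | search-finds (t ∘ inject₁) i t₀≢nothing
  ... | just x  | _ = found (result tᵢ≡) tᵢ≡ ℕ.≤-refl
    λ j i<j j≤i → contradiction i<j (ℕ.≤⇒≯ j≤i)
    where
    result : ∀ {x} → t (suc i) ≡ just x → search t (suc i) ≡ just (suc i , x)
    result eq rewrite eq = refl
  ... | nothing | found {s} res entry s≤i gap = found (result tᵢ≡ res) entry
      (ℕ.≤-trans (ℕ.≤-reflexive (Fin.toℕ-inject₁ s)) (ℕ.m≤n⇒m≤1+n s≤i)) gap′
    where
    result : ∀ {z} → t (suc i) ≡ nothing → search (t ∘ inject₁) i ≡ just z →
             search t (suc i) ≡ just (inject₁ (proj₁ z) , proj₂ z)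
    result eq eq′ rewrite eq | eq′ = refl
    gap′ : ∀ j → inject₁ s Fin.< j → j Fin.≤ suc i → t j ≡ nothing
    gap′ j s<j j≤1+i with j Fin.≟ suc i
    ... | yes refl = tᵢ≡
    ... | no j≢1+i = subst (λ k → t k ≡ nothing) (Fin.inject₁-lower₁ j n≢j)
        (gap (lower₁ j n≢j)
          (subst₂ ℕ._<_ (Fin.toℕ-inject₁ s) (sym (Fin.toℕ-lower₁ j n≢j)) s<j)
          (subst (ℕ._≤ toℕ i) (sym (Fin.toℕ-lower₁ j n≢j)) (ℕ.s≤s⁻¹ j<1+i)))
      where
      j<1+i : toℕ j ℕ.< suc (toℕ i)
      j<1+i = ℕ.≤∧≢⇒< j≤1+i (j≢1+i ∘ Fin.toℕ-injective)
      n≢j : suc n ≢ toℕ j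
      n≢j = ℕ.>⇒≢ (ℕ.<-≤-trans j<1+i (Fin.toℕ<n i))

  module Correctness (0<pΔ : 0# < pΔ) ([pmax-pmin]/pΔ≈r : (pmax - pmin) / pΔ ≈ fromℤ (+ r))
    (p : Ptr → Carrier) (p-q : p q ≡ pmin - pΔ) where

    open FloorProperties.Grid R pmin pmax pΔ 0<pΔ r [pmax-pmin]/pΔ≈r

    slot : Ptr → ℤ
    slot x = ⌊ (p x - p q) / pΔ ⌋

    slot-q : slot q ≡ + 0
    slot-q = ⌊[x-x]/pΔ⌋≡0 (p q)

    InRange-level : ∀ {x} → InRange (p x) →
                    ∃[ k ] k ℕ.< r × ⌊ (p x - pmin) / pΔ ⌋ ≡ + k × slot x ≡ + suc k
    InRange-level {x} (pmin≤px , px<pmax) with k , k<r , eq ← level pmin≤px px<pmax =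
      k , k<r , eq , subst (λ pq → ⌊ (p x - pq) / pΔ ⌋ ≡ + suc k) (sym p-q) (slot-level eq)

    level-mono⇒slot-mono : ∀ {x y} → InRange (p x) → InRange (p y) →
                           ⌊ (p x - pmin) / pΔ ⌋ ℤ.< ⌊ (p y - pmin) / pΔ ⌋ → slot x ℤ.< slot y
    level-mono⇒slot-mono x∈ y∈ lx<ly
      with k , _ , lx≡k , sx≡1+k ← InRange-level x∈
         | l , _ , ly≡l , sy≡1+l ← InRange-level y∈ =
      subst₂ ℤ._<_ (sym sx≡1+k) (sym sy≡1+l)
        (ℤ.+<+ (s≤s (ℤ.drop‿+<+ (subst₂ ℤ._<_ lx≡k ly≡l lx<ly))))

    InRange-slot : ∀ {x} → InRange (p x) → ∃[ i ] slot x ≡ + toℕ {suc r} (suc i)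
    InRange-slot x∈ with k , k<r , _ , sx≡1+k ← InRange-level x∈ =
      fromℕ< k<r , trans sx≡1+k (cong (+_ ∘ suc) (sym (Fin.toℕ-fromℕ< k<r)))

    Storable : Ptr → Set (a ⊔ ℓ₁ ⊔ ℓ₂)
    Storable x = x ≡ q ⊎ InRange (p x)

    Storable-slot : ∀ {x} → Storable x → ∃[ i ] slot x ≡ + toℕ {suc r} i
    Storable-slot (inj₁ refl) = zero , slot-q
    Storable-slot (inj₂ x∈) with i , eq ← InRange-slot x∈ = suc i , eq

    infix 4 _◁_
    _◁_ : Rel Ptr a
    x ◁ y = x ≢ y × slot x ℤ.≤ slot y

    inSlot? : (i : Fin (suc r)) → Decidable (λ x → slot x ≡ + toℕ i)
    inSlot? i x = slot x ℤ.≟ + toℕ i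

    slot-unique : ∀ {x i j} → slot x ≡ + toℕ {suc r} i → slot x ≡ + toℕ {suc r} j → i ≡ j
    slot-unique eq eq′ = Fin.toℕ-injective (ℤ.+-injective (trans (sym eq) eq′))

    lastInSlot : Fin (suc r) → List Ptr → Maybe Ptr
    lastInSlot i l = last (filter (inSlot? i) l)

    record Represents (σ : State) (l : List Ptr) : Set (c ⊔ a ⊔ ℓ₁ ⊔ ℓ₂) where
      field
        prio≡    : ∀ x → prio (mem σ x) ≡ p x
        ring     : Ring (mem σ) l
        ordered  : AllPairs _◁_ l
        storable : All Storable l
        table    : ∀ i → qlt σ i ≡ lastInSlot i l

    open Represents

    table-just : ∀ {σ l i x} → Represents σ l → qlt σ i ≡ just x →
                 ∃₂ λ xs ys → l ≡ xs ++ x ∷ ys × slot x ≡ + toℕ i × All (λ y → slot y ≢ + toℕ i) ys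
    table-just {l = l} {i} rep eq = last-filter-just (inSlot? i) l (trans (sym (table rep i)) eq)

    table-nothing : ∀ {σ l i} → Represents σ l → qlt σ i ≡ nothing →
                    All (λ y → slot y ≢ + toℕ i) l
    table-nothing {l = l} {i} rep eq =
      last-filter-nothing (inSlot? i) l (trans (sym (table rep i)) eq)

    Represented : State → Set (c ⊔ a ⊔ ℓ₁ ⊔ ℓ₂)
    Represented σ = ∃[ es ] Represents σ (q ∷ es)

    Represents⇒Represented : ∀ {σ} xs {x ys} → Represents σ (xs ++ x ∷ ys) → Represented σ
    Represents⇒Represented [] {x} {ys} rep with _ ∷ _ ← path (ring rep) = ys , rep
    Represents⇒Represented (_ ∷ xs) {x} {ys} rep with _ ∷ _ ← path (ring rep) =
      xs ++ x ∷ ys , rep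

    qltSlot≡slot : ∀ m → (∀ x → prio (m x) ≡ p x) → ∀ x → qltSlot m x ≡ slot x
    qltSlot≡slot m eq x = cong₂ (λ u v → ⌊ (u - v) / pΔ ⌋) (eq x) (eq q)

    module _ {σ es} (rep : Represents σ (q ∷ es)) where

      qlt₀≢nothing : qlt σ zero ≢ nothing
      qlt₀≢nothing eq with q∉0 ∷ _ ← table-nothing rep eq = q∉0 slot-q

      es≢q : All (_≢ q) es
      es≢q with q◁es ∷ _ ← ordered rep = All.map (λ { (q≢x , _) → q≢x ∘ sym }) q◁es

      dequeueOrder : DequeueOrder σ es
      dequeueOrder with _ ∷ path ← path (ring rep) = Path⇒Traversal path es≢q

      Queued⇒∈ : ∀ {e} → Queued e σ → e ∈ es
      Queued⇒∈ (es′ , t , e∈es′) = subst (_ ∈_) (Traversal-functional t dequeueOrder) e∈es′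

      ∈⇒InRange : ∀ {e} → e ∈ es → InRange (p e)
      ∈⇒InRange e∈es with _ ∷ ss ← storable rep | All.lookup es≢q e∈es
      ... | e≢q with All.lookup ss e∈es
      ...   | inj₁ e≡q = contradiction e≡q e≢q
      ...   | inj₂ e∈  = e∈

      Represents⇒Invariant : Invariant σ
      Represents⇒Invariant = es , dequeueOrder , inOrder
        where
        inOrder : ∀ i j →
                  let pᵢ = prio (mem σ (lookup es i))
                      pⱼ = prio (mem σ (lookup es j))
                  in InRange pᵢ → InRange pⱼ →
                  ⌊ (pᵢ - pmin) / pΔ ⌋ ℤ.< ⌊ (pⱼ - pmin) / pΔ ⌋ → i Fin.< j
        inOrder i j i∈ j∈ rewrite prio≡ rep (lookup es i) | prio≡ rep (lookup es j) =
          go ∘ level-mono⇒slot-mono i∈ j∈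
          where
          go : slot (lookup es i) ℤ.< slot (lookup es j) → i Fin.< j
          go sᵢ<sⱼ with Fin.<-cmp i j
          ... | tri< i<j _ _ = i<j
          ... | tri≈ _ refl _ = contradiction sᵢ<sⱼ (ℤ.<-irrefl refl)
          ... | tri> _ _ j<i with _ ∷ es◁ ← ordered rep =
            contradiction sᵢ<sⱼ (ℤ.≤⇒≯ (proj₂ (AllPairs-lookup es◁ j<i)))

    Represents-insert : ∀ {σ} xs {x ys e t} → Represents σ (xs ++ x ∷ ys) → e ≢ q →
                        All (_≢ e) (xs ++ x ∷ ys) → InRange (p e) →
                        slot x ℤ.≤ slot e → All (λ y → slot e ℤ.≤ slot y) ys →
                        (∀ i → t i ≡ lastInSlot i (xs ++ x ∷ e ∷ ys)) →
                        Represents (record { mem = linkAfter x e (mem σ) ; qlt = t })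
                                   (xs ++ x ∷ e ∷ ys)
    Represents-insert {σ} xs {x} {ys} {e} rep e≢q l≢e e∈ x≤e e≤ys t≡
      with xs◁x , x◁ys , rest ← AllPairs-middle⁻ xs (ordered rep)
         | xs≢e , x≢e ∷ ys≢e ← AllP.++⁻ xs l≢e
         | ss , s ∷ ss′ ← AllP.++⁻ xs (storable rep) = record
      { prio≡    = λ z → trans (prio-linkBetween x e (next (mem σ x)) (mem σ) z) (prio≡ rep z)
      ; ring     = Ring-insert xs (ring rep) e≢q (AllPairs.map proj₁ (ordered rep)) l≢e
      ; ordered  = AllPairs-middle⁺ xs xs◁x ((x≢e , x≤e) ∷ x◁ys)
          (AllPairs-middle⁺ xs
            (All.zipWith (λ { ((_ , z≤x) , z≢e) → z≢e , ℤ.≤-trans z≤x x≤e }) (xs◁x , xs≢e))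
            (All.zipWith (λ { (z≢e , e≤z) → z≢e ∘ sym , e≤z }) (ys≢e , e≤ys))
            rest)
      ; storable = AllP.++⁺ ss (s ∷ inj₂ e∈ ∷ ss′)
      ; table    = t≡
      }

    lastInSlot-skip : ∀ {i} xs {x e ys} → slot e ≢ + toℕ i →
                      lastInSlot i (xs ++ x ∷ e ∷ ys) ≡ lastInSlot i (xs ++ x ∷ ys)
    lastInSlot-skip {i} xs {x} {e} {ys} e≢i = cong last
      (subst₂ (λ l l′ → filter (inSlot? i) l ≡ filter (inSlot? i) l′)
        (++-assoc xs [ x ] (e ∷ ys)) (++-assoc xs [ x ] ys)
        (filter-skip (inSlot? i) (xs ++ [ x ]) e≢i))

    lastInSlot-suffix : ∀ {i} xs {x e ys} → filter (inSlot? i) ys ≢ [] →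
                        lastInSlot i (xs ++ x ∷ e ∷ ys) ≡ lastInSlot i (xs ++ x ∷ ys)
    lastInSlot-suffix {i} xs {x} {e} {ys} ys≢[] = trans
      (subst (λ l → lastInSlot i l ≡ lastInSlot i ys) (++-assoc xs (x ∷ [ e ]) ys)
        (last-filter-++ (inSlot? i) (xs ++ x ∷ [ e ]) ys≢[]))
      (subst (λ l → lastInSlot i ys ≡ lastInSlot i l) (++-assoc xs [ x ] ys)
        (sym (last-filter-++ (inSlot? i) (xs ++ [ x ]) ys≢[])))

    lastInSlot-≡ : ∀ {i} xs {x ys} → slot x ≡ + toℕ i → filter (inSlot? i) ys ≡ [] →
                   lastInSlot i (xs ++ x ∷ ys) ≡ just x
    lastInSlot-≡ {i} xs {x} x∈i eq =
      trans (last-filter-++-∷ (inSlot? i) xs x∈i) (cong (last ∘ (x ∷_)) eq)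

    module _ {σ e es} {s : Fin (suc r)} (rep : Represents σ (q ∷ es)) (e≢q : e ≢ q) (e∉es : ¬ e ∈ es)
             (e∈ : InRange (p e)) (e∈s : slot e ≡ + toℕ s) where

      private
        l≢e : All (_≢ e) (q ∷ es)
        l≢e = e≢q ∘ sym ∷ All.tabulate λ { y∈es refl → e∉es y∈es }

      insert-before : ∀ {x} → qlt σ s ≡ just x →
                      Represented (record { mem = linkBefore x e (mem σ) ; qlt = qlt σ })
      insert-before {x} qlt≡
        with us , vs , l≡ , x∈s , _ ← table-just rep qlt≡
        with subst (x ∈_) (sym l≡) (∈-++⁺ʳ us (here refl))
      ... | here refl
        with _ , e∈1+i ← InRange-slot e∈
        with refl ← slot-unique e∈s e∈1+i = contradiction (slot-unique x∈s slot-q) λ ()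
      ... | there x∈es
        with xs , w , ys , l≡ ← predecessor {z = q} x∈es
        with rep′ ← subst (Represents σ) l≡ rep
        with _ , (_ , w≤x) ∷ _ , rest ← AllPairs-middle⁻ xs (ordered rep′)
        with _ , x◁ys , _ ← AllPairs-middle⁻ xs rest =
        Represents⇒Represented xs (subst
          (λ m → Represents (record { mem = m ; qlt = qlt σ }) (xs ++ w ∷ e ∷ x ∷ ys))
          (cong₂ (λ u v → linkBetween u e v (mem σ))
            (sym (Ring-prev xs (ring rep′))) (Ring-next xs (ring rep′)))
          (Represents-insert xs rep′ e≢q (subst (All (_≢ e)) l≡ l≢e) e∈
            (subst (slot w ℤ.≤_) x≡e w≤x)
            (subst (λ i → All (λ y → i ℤ.≤ slot y) (x ∷ ys)) x≡e
              (ℤ.≤-refl ∷ All.map proj₂ x◁ys))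
            table′))
        where
        x≡e : slot x ≡ slot e
        x≡e = trans x∈s (sym e∈s)
        table′ : ∀ i → qlt σ i ≡ lastInSlot i (xs ++ w ∷ e ∷ x ∷ ys)
        table′ i with slot e ℤ.≟ + toℕ i
        ... | no  e∉i = trans (table rep′ i) (sym (lastInSlot-skip xs e∉i))
        ... | yes e∈i = trans (table rep′ i) (sym
          (lastInSlot-suffix xs (filter-∷-≢[] (inSlot? i) (trans x≡e e∈i))))

      insert-after : ∀ {s′ x} → qlt σ s′ ≡ just x → s′ Fin.≤ s → s′ ≢ s →
                     (∀ j → s′ Fin.< j → j Fin.≤ s → qlt σ j ≡ nothing) →
                     Represented (record { mem = linkAfter x e (mem σ)
                                         ; qlt = updateAt (qlt σ) s (const (just e)) })
      insert-after {s′} {x} qlt≡ s′≤s s′≢s gap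
        with xs , ys , l≡ , x∈s′ , ys∉s′ ← table-just rep qlt≡
        with rep′ ← subst (Represents σ) l≡ rep
        with _ , x◁ys , _ ← AllPairs-middle⁻ xs (ordered rep′)
           | _ , _ ∷ ss ← AllP.++⁻ xs (storable rep′) =
        Represents⇒Represented xs
          (Represents-insert xs rep′ e≢q (subst (All (_≢ e)) l≡ l≢e) e∈
            (subst₂ ℤ._≤_ (sym x∈s′) (sym e∈s) (ℤ.+≤+ s′≤s))
            (All.map ℤ.<⇒≤ e<ys) table′)
        where
        e<ys : All (λ y → slot e ℤ.< slot y) ys
        e<ys = All.tabulate beyond
          where
          beyond : ∀ {y} → y ∈ ys → slot e ℤ.< slot y
          beyond {y} y∈ys with j , y∈j ← Storable-slot (All.lookup ss y∈ys) | toℕ j ℕ.≤? toℕ s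
          ... | no  j≰s = subst₂ ℤ._<_ (sym e∈s) (sym y∈j) (ℤ.+<+ (ℕ.≰⇒> j≰s))
          ... | yes j≤s = contradiction y∈j (All.lookup
            (table-nothing rep′ (gap j s′<j j≤s))
            (∈-++⁺ʳ xs (there y∈ys)))
            where
            s′≤j : s′ Fin.≤ j
            s′≤j = ℤ.drop‿+≤+ (subst₂ ℤ._≤_ x∈s′ y∈j (proj₂ (All.lookup x◁ys y∈ys)))
            s′<j : s′ Fin.< j
            s′<j = ℕ.≤∧≢⇒< s′≤j λ s′≡j →
              All.lookup ys∉s′ y∈ys (trans y∈j (cong +_ (sym s′≡j)))
        table′ : ∀ i → updateAt (qlt σ) s (const (just e)) i ≡ lastInSlot i (xs ++ x ∷ e ∷ ys)
        table′ i with i Fin.≟ s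
        ... | yes refl = trans (updateAt-updates s (qlt σ)) (sym
          (subst (λ l → lastInSlot s l ≡ just e) (++-assoc xs [ x ] (e ∷ ys))
            (lastInSlot-≡ (xs ++ [ x ]) e∈s (filter-none (inSlot? s)
              (All.map (λ e<y y∈s → ℤ.<-irrefl (trans e∈s (sym y∈s)) e<y) e<ys)))))
        ... | no  i≢s = begin
          updateAt (qlt σ) s (const (just e)) i ≡⟨ updateAt-minimal i s (qlt σ) i≢s ⟩
          qlt σ i                               ≡⟨ table rep′ i ⟩
          lastInSlot i (xs ++ x ∷ ys)           ≡⟨ lastInSlot-skip xs (i≢s ∘ flip slot-unique e∈s) ⟨
          lastInSlot i (xs ++ x ∷ e ∷ ys)       ∎
          where open ≡.≡-Reasoning

    insert-≡ : ∀ {e σ s s′ x} →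
               index (qltSlot (mem σ) e) ≡ just s → search (qlt σ) s ≡ just (s′ , x) →
               insert e σ ≡ just (if does (s′ Fin.≟ s)
                 then record { mem = linkBefore x e (mem σ) ; qlt = qlt σ }
                 else record { mem = linkAfter x e (mem σ)
                             ; qlt = updateAt (qlt σ) s (const (just e)) })
    insert-≡ eq eq′ rewrite eq | eq′ = refl

    insert-represented : ∀ {σ e} → Represented σ →
                         e ≢ q → ¬ Queued e σ → InRange (prio (mem σ e)) →
                         Any Represented (insert e σ)
    insert-represented {σ} {e} (es , rep) e≢q ¬queued e∈′
      with e∈ ← subst InRange (prio≡ rep e) e∈′
      with i , e∈s ← InRange-slot e∈
      with e∉es ← (λ e∈es → ¬queued (es , dequeueOrder rep , e∈es))
      with found {s′} {x} result entry s′≤s gap ← search-finds (qlt σ) (suc i) (qlt₀≢nothing rep) =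
      subst (Any Represented) (sym (insert-≡ index≡ result)) inserted
      where
      index≡ : index (qltSlot (mem σ) e) ≡ just (suc i)
      index≡ = trans (cong index (trans (qltSlot≡slot (mem σ) (prio≡ rep) e) e∈s))
        (index-toℕ (suc i))
      inserted : Any Represented (just (if does (s′ Fin.≟ suc i)
        then record { mem = linkBefore x e (mem σ) ; qlt = qlt σ }
        else record { mem = linkAfter x e (mem σ)
                    ; qlt = updateAt (qlt σ) (suc i) (const (just e)) }))
      inserted with s′ Fin.≟ suc i
      ... | yes refl = just (insert-before rep e≢q e∉es e∈ e∈s entry)
      ... | no s′≢s  = just (insert-after rep e≢q e∉es e∈ e∈s entry s′≤s s′≢s gap)

    extract-table : State → Ptr → Fin (suc r) → Table r
    extract-table σ e s =
      if does (≡-dec _≟_ (qlt σ s) (just e))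
      then updateAt (qlt σ) s (const
             (if does (qltSlot m (prev (m e)) ℤ.≟ qltSlot m e)
              then just (prev (m e))
              else nothing))
      else qlt σ
      where
      m = unlink e (mem σ)

    extract-≡ : ∀ e σ {s} → index (qltSlot (unlink e (mem σ)) e) ≡ just s →
                extract e σ ≡ just (record { mem = unlink e (mem σ)
                                           ; qlt = extract-table σ e s })
    extract-≡ e σ eq rewrite eq = refl

    extract-table-≡ : ∀ {σ e s} xs {x ys} → Represents σ (xs ++ x ∷ e ∷ ys) → slot e ≡ + toℕ s →
                      ∀ i → extract-table σ e s i ≡ lastInSlot i (xs ++ x ∷ ys)
    extract-table-≡ {σ} {e} {s} xs {x} {ys} rep e∈s
      with xs◁x , (_ , x≤e) ∷ _ , rest ← AllPairs-middle⁻ xs (ordered rep)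
      with _ , e◁ys , _ ← AllPairs-middle⁻ xs rest
      with ≡-dec _≟_ (qlt σ s) (just e)
    ... | no qlt≢e = unchanged
      where
      unchanged : ∀ i → qlt σ i ≡ lastInSlot i (xs ++ x ∷ ys)
      unchanged i with i Fin.≟ s
      ... | no i≢s = trans (table rep i) (lastInSlot-skip xs (i≢s ∘ flip slot-unique e∈s))
      ... | yes refl = trans (table rep s) (lastInSlot-suffix xs λ ys≡[] → qlt≢e (trans
        (table rep s)
        (subst (λ l → lastInSlot s l ≡ just e) (++-assoc xs [ x ] (e ∷ ys))
          (lastInSlot-≡ (xs ++ [ x ]) e∈s ys≡[]))))
    ... | yes qlt≡e = changed
      where
      m = unlink e (mem σ)
      prio-m : ∀ z → prio (m z) ≡ p z
      prio-m z = trans (prio-unlink e (mem σ) z) (prio≡ rep z)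
      prev-e : prev (m e) ≡ x
      prev-e = proj₂ (Ring-extract xs (ring rep) (AllPairs.map proj₁ (ordered rep)))
      slot-prev-e : qltSlot m (prev (m e)) ≡ slot x
      slot-prev-e = trans (cong (qltSlot m) prev-e) (qltSlot≡slot m prio-m x)
      slot-e : qltSlot m e ≡ slot e
      slot-e = qltSlot≡slot m prio-m e
      ys≡[] : filter (inSlot? s) ys ≡ []
      ys≡[] with filter (inSlot? s) ys in ys≡
      ... | []     = refl
      ... | z ∷ zs = contradiction refl (proj₁ (All.lookup e◁ys e∈ys))
        where
        last≡e : last (filter (inSlot? s) ys) ≡ just e
        last≡e = begin
          lastInSlot s ys                        ≡⟨ last-filter-++ (inSlot? s) (xs ++ x ∷ [ e ]) ys≢[] ⟨
          lastInSlot s ((xs ++ x ∷ [ e ]) ++ ys) ≡⟨ cong (lastInSlot s) (++-assoc xs (x ∷ [ e ]) ys) ⟩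
          lastInSlot s (xs ++ x ∷ e ∷ ys)        ≡⟨ table rep s ⟨
          qlt σ s                                ≡⟨ qlt≡e ⟩
          just e                                 ∎
          where
          open ≡.≡-Reasoning
          ys≢[] : filter (inSlot? s) ys ≢ []
          ys≢[] = subst (_≢ []) (sym ys≡) λ ()
        e∈ys : e ∈ ys
        e∈ys with us , vs , ys≡ , _ ← last-filter-just (inSlot? s) ys last≡e =
          subst (e ∈_) (sym ys≡) (∈-++⁺ʳ us (here refl))
      occupant : Maybe Ptr
      occupant =
        if does (qltSlot m (prev (m e)) ℤ.≟ qltSlot m e)
        then just (prev (m e))
        else nothing
      occupant≡ : occupant ≡ lastInSlot s (xs ++ x ∷ ys)
      occupant≡ with qltSlot m (prev (m e)) ℤ.≟ qltSlot m e
      ... | yes eq = trans (cong just prev-e) (sym (lastInSlot-≡ xs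
        (trans (sym slot-prev-e) (trans eq (trans slot-e e∈s))) ys≡[]))
      ... | no neq = sym (cong last (filter-none (inSlot? s) (AllP.++⁺
        (All.map (λ { (_ , z≤x) z∈s → ℤ.<⇒≱ x<s (subst (ℤ._≤ slot x) z∈s z≤x) }) xs◁x)
        ((λ x∈s → ℤ.<-irrefl x∈s x<s) ∷ filter≡[]⇒none (inSlot? s) ys ys≡[]))))
        where
        x<s : slot x ℤ.< + toℕ s
        x<s = subst (slot x ℤ.<_) e∈s (ℤ.≤∧≢⇒< x≤e λ x≡e →
          neq (trans slot-prev-e (trans x≡e (sym slot-e))))
      changed : ∀ i → updateAt (qlt σ) s (const occupant) i ≡ lastInSlot i (xs ++ x ∷ ys)
      changed i with i Fin.≟ s
      ... | yes refl = trans (updateAt-updates s (qlt σ)) occupant≡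
      ... | no i≢s   = begin
        updateAt (qlt σ) s (const occupant) i ≡⟨ updateAt-minimal i s (qlt σ) i≢s ⟩
        qlt σ i                               ≡⟨ table rep i ⟩
        lastInSlot i (xs ++ x ∷ e ∷ ys)       ≡⟨ lastInSlot-skip xs (i≢s ∘ flip slot-unique e∈s) ⟩
        lastInSlot i (xs ++ x ∷ ys)           ∎
        where open ≡.≡-Reasoning

    extract-represented : ∀ {σ e} → Represented σ → Queued e σ → Any Represented (extract e σ)
    extract-represented {σ} {e} (es , rep) queued
      with e∈es ← Queued⇒∈ rep queued
      with i , e∈s ← InRange-slot (∈⇒InRange rep e∈es)
      with xs , x , ys , l≡ ← predecessor {z = q} e∈es
      with rep′ ← subst (Represents σ) l≡ rep
      with xs◁x , _ ∷ x◁ys , rest ← AllPairs-middle⁻ xs (ordered rep′)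
         | ss , s ∷ _ ∷ ss′ ← AllP.++⁻ xs (storable rep′)
      with _ , _ , rest′ ← AllPairs-middle⁻ xs rest =
      subst (Any Represented) (sym (extract-≡ e σ index≡)) (just (Represents⇒Represented xs (record
        { prio≡    = prio-m
        ; ring     = proj₁ (Ring-extract xs (ring rep′) (AllPairs.map proj₁ (ordered rep′)))
        ; ordered  = AllPairs-middle⁺ xs xs◁x x◁ys rest′
        ; storable = AllP.++⁺ ss (s ∷ ss′)
        ; table    = extract-table-≡ xs rep′ e∈s
        })))
      where
      prio-m : ∀ z → prio (unlink e (mem σ) z) ≡ p z
      prio-m z = trans (prio-unlink e (mem σ) z) (prio≡ rep z)
      index≡ : index (qltSlot (unlink e (mem σ)) e) ≡ just (suc i)
      index≡ = trans (cong index (trans (qltSlot≡slot (unlink e (mem σ)) prio-m e) e∈s))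
        (index-toℕ (suc i))

    exec-represented : ∀ {σ call} → Represented σ → Valid σ call →
                       Any Represented (exec call σ)
    exec-represented rep (insert-valid e≢q ¬queued e∈) = insert-represented rep e≢q ¬queued e∈
    exec-represented rep (extract-valid queued)        = extract-represented rep queued

    build-represented : ∀ m → (∀ x → prio (mem (build m) x) ≡ p x) → Represented (build m)
    build-represented m prio-eq = [] , record
      { prio≡    = prio-eq
      ; ring     = record
        { path      = q ∷ Path-respˡ (sym next-q) []
        ; prev-next = trans (cong (prev ∘ mem (build m)) next-q) prev-q ∷ []
        }
      ; ordered  = [] ∷ []
      ; storable = inj₁ refl ∷ []
      ; table    = λ { zero    → sym (cong last (filter-accept (inSlot? zero) slot-q))
                     ; (suc i) → sym (cong last (filter-reject (inSlot? (suc i))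
                         (λ q∈1+i → contradiction (slot-unique {x = q} slot-q q∈1+i) λ ()))) }
      }
      where
      m₁ = setNext q q m
      m₂ = setPrev q q m₁
      next-q : next (mem (build m) q) ≡ q
      next-q = begin
        next (mem (build m) q) ≡⟨ modify-preserves next q (withPrio (pmin - pΔ)) m₂ q (λ _ → refl) ⟩
        next (m₂ q)            ≡⟨ next-setPrev q q m₁ q ⟩
        next (m₁ q)            ≡⟨ next-setNext-≡ q q m ⟩
        q                      ∎
        where open ≡.≡-Reasoning
      prev-q : prev (mem (build m) q) ≡ q
      prev-q = trans (modify-preserves prev q (withPrio (pmin - pΔ)) m₂ q λ _ → refl)
        (prev-setPrev-≡ q q m₁)

  module _ (0<pΔ : 0# < pΔ) ([pmax-pmin]/pΔ≈r : (pmax - pmin) / pΔ ≈ fromℤ (+ r)) where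

    open Correctness 0<pΔ [pmax-pmin]/pΔ≈r

    Reachable⇒Represented : ∀ {σ} → Reachable σ →
                            ∃[ p ] Σ[ p-q ∈ p q ≡ pmin - pΔ ] Represented p p-q σ
    Reachable⇒Represented (built m) =
      prio ∘ mem (build m) , prio-q , build-represented _ prio-q m λ _ → refl
      where
      prio-q : prio (mem (build m) q) ≡ pmin - pΔ
      prio-q = cong prio (modify-≡ q (withPrio (pmin - pΔ)) (setPrev q q (setNext q q m)))
    Reachable⇒Represented (called call reachable valid eq)
      with p , p-q , rep ← Reachable⇒Represented reachable =
      p , p-q , drop-just (subst (Any (Represented p p-q)) eq (exec-represented p p-q rep valid))

    exec-Invariant : ∀ {σ call} → Reachable σ → Valid σ call → Any Invariant (exec call σ)
    exec-Invariant reachable valid with p , p-q , rep ← Reachable⇒Represented reachable =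
      MaybeAny.map (λ { (_ , rep) → Represents⇒Invariant p p-q rep })
        (exec-represented p p-q rep valid)

lemma1 : ∀ {c ℓ₁ ℓ₂ a} (R : FlooredField c ℓ₁ ℓ₂) →
    let open FlooredField R in
    {Ptr : Set a} (_≟_ : DecidableEquality Ptr) (q : Ptr)
    (pmin pmax pΔ : Carrier) → 0# < pΔ → pmin < pmax →
    (r : ℕ) → (pmax - pmin) / pΔ ≈ fromℤ (+ r) →
    let open MRPQ R _≟_ q pmin pmax pΔ r in
    (σ : State) → Reachable σ → Invariant σ →
    (call : Call) → Valid σ call → Any Invariant (exec call σ)
lemma1 R _≟_ q pmin pmax pΔ 0<pΔ _ r [pmax-pmin]/pΔ≈r σ reachable _ call valid =
  MRPQProperties.exec-Invariant R _≟_ q pmin pmax pΔ r 0<pΔ [pmax-pmin]/pΔ≈r reachable valid
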